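{- Let $n\ge 2$, let $\overrightarrow{v}=(a_1,\dots,a_n)$ be an $n$-tuple of distinct elements of an ordered abelian group, and let $k$ be an integer with $1\le k\le n!-1$. Then there exists a $k\times n$ $\overrightarrow{v}$-row permuted matrix $A$ satisfying the distinct column sum property (DCS).
   Context: An ordered abelian group is an abelian group with a translation-invariant total order. Given an $n$-tuple $\overrightarrow{v}=(a_1,\dots,a_n)$ of distinct elements of an ordered abelian group, a $k\times n$ matrix $A=(\alpha_{i,j})$ is called a $\overrightarrow{v}$-row permuted matrix if the rows of $A$ are distinct permutations of the components of $\overrightarrow{v}$ (each row is a permutation of $(a_1,\dots,a_n)$ and no two rows are equal). Such a matrix satisfies the distinct column sum property (DCS) if its column sums $\sum_{i=1}^k\alpha_{i,j}$, $1\le j\le n$, are pairwise distinct. -}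

module Defs where

open import Algebra.Bundles using (AbelianGroup)
open import Algebra.Core using (Op₁; Op₂)
open import Algebra.Structures using (IsAbelianGroup)
import Algebra.Properties.CommutativeMonoid.Sum as Sum
open import Data.Fin.Permutation using (Permutation′; _⟨$⟩ʳ_)
open import Data.Nat.Base using (ℕ)
open import Data.Product.Base using (Σ-syntax)
open import Data.Vec.Functional using (Vector)
import Data.Vec.Functional.Relation.Binary.Equality.Setoid as VectorEquality
open import Level using (Level; suc; _⊔_)
open import Relation.Binary.Core using (Rel)
open import Relation.Binary.Definitions using (LeftMonotonic)
open import Relation.Binary.PropositionalEquality.Core using (_≢_)
open import Relation.Binary.Structures using (IsTotalOrder)
open import Relation.Nullary.Negation.Core using (¬_)

-- By commutativity, left monotonicity is full translation invariance.
-- Neither _≈_ nor _≤_ is assumed to be decidable.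
record OrderedAbelianGroup (c ℓ₁ ℓ₂ : Level) : Set (suc (c ⊔ ℓ₁ ⊔ ℓ₂)) where
  infix  8 -_
  infixl 6 _+_
  infix  4 _≈_ _≤_
  field
    Carrier        : Set c
    _≈_            : Rel Carrier ℓ₁
    _≤_            : Rel Carrier ℓ₂
    _+_            : Op₂ Carrier
    0#             : Carrier
    -_             : Op₁ Carrier
    isAbelianGroup : IsAbelianGroup _≈_ _+_ 0# -_
    isTotalOrder   : IsTotalOrder _≈_ _≤_
    +-monoʳ-≤      : LeftMonotonic _≤_ _≤_ _+_

  abelianGroup : AbelianGroup c ℓ₁
  abelianGroup = record { isAbelianGroup = isAbelianGroup }

  open AbelianGroup abelianGroup public
    using (setoid; commutativeMonoid; _≉_)

module _ {c ℓ₁ ℓ₂} (G : OrderedAbelianGroup c ℓ₁ ℓ₂) where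
  open OrderedAbelianGroup G
  open Sum commutativeMonoid using (sum)
  open VectorEquality setoid using (_≋_)

  Matrix : ℕ → ℕ → Set c
  Matrix k n = Vector (Vector Carrier n) k

  PairwiseDistinct : ∀ {n} → Vector Carrier n → Set ℓ₁
  PairwiseDistinct v = ∀ i j → i ≢ j → v i ≉ v j

  -- The library's _↭_ on vectors compares entries by _≡_ rather than _≈_.
  _IsRearrangementOf_ : ∀ {n} → Vector Carrier n → Vector Carrier n → Set ℓ₁
  _IsRearrangementOf_ {n} w v = Σ[ π ∈ Permutation′ n ] w ≋ (λ j → v (π ⟨$⟩ʳ j))

  record IsRowPermuted {k n} (v : Vector Carrier n) (A : Matrix k n) : Set ℓ₁ where
    field
      rows-permute  : ∀ i → A i IsRearrangementOf v
      rows-distinct : ∀ i j → i ≢ j → ¬ (A i ≋ A j)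

  columnSum : ∀ {k n} → Matrix k n → Vector Carrier n
  columnSum A j = sum (λ i → A i j)

  DCS : ∀ {k n} → Matrix k n → Set ℓ₁
  DCS A = PairwiseDistinct (columnSum A)

{-# OPTIONS --safe #-}
module Submission where

open import Defs
open import Data.Nat.Base using (ℕ; _≤_; _∸_; _!)
open import Data.Product.Base using (Σ-syntax; _×_)
open import Data.Vec.Functional using (Vector)

open import Algebra.Bundles using (AbelianGroup)
import Algebra.Properties.CommutativeMonoid.Sum as Sum
import Algebra.Properties.CommutativeSemigroup as CommutativeSemigroupProperties
open import Data.Fin.Base as Fin using (Fin; zero; suc; inject₁; fromℕ; punchIn; punchOut)
open import Data.Fin.Permutation as Perm
  using (Permutation′; _⟨$⟩ʳ_; _∘ₚ_; insert; insert-punchIn)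
import Data.Fin.Properties as Fin
open import Data.List.Base
  using (List; []; _∷_; _++_; length; map; concat; tabulate; foldr; lookup)
open import Data.List.Membership.Propositional.Properties using (∈-lookup)
import Data.List.Properties as List
import Data.List.Relation.Binary.Pointwise as Pointwise
open import Data.List.Relation.Binary.Sublist.Heterogeneous.Properties using (fromPointwise)
open import Data.List.Relation.Binary.Sublist.Propositional
  using (_⊆_; []; _∷_; _∷ʳ_; ⊆-refl; ⊆-trans; minimum)
import Data.List.Relation.Binary.Sublist.Propositional.Properties as Sublist
import Data.List.Relation.Binary.Sublist.Setoid.Properties as SublistSetoid
open import Data.List.Relation.Unary.All as All using (All; []; _∷_)
import Data.List.Relation.Unary.All.Properties as All
open import Data.List.Relation.Unary.AllPairs as AllPairs using (AllPairs; []; _∷_)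
import Data.List.Relation.Unary.AllPairs.Properties as AllPairs
open import Data.Nat.Base as ℕ using (zero; suc; z≤n; s≤s; z<s; s<s)
import Data.Nat.Properties as ℕ
open import Data.Product.Base using (∃; _,_; proj₂)
open import Data.Sum.Base using (_⊎_; inj₁; inj₂)
open import Data.Vec.Functional using (head; tail)
open import Function.Base using (_∘_; const)
open import Function.Bundles using (Injection)
open import Function.Properties.Inverse using (↔⇒↣)
open import Level using (Level; _⊔_)
open import Relation.Binary.Bundles using (Poset)
import Relation.Binary.Construct.NonStrictToStrict as ToStrict
open import Relation.Binary.Core using (Rel)
open import Relation.Binary.Definitions using (Transitive; tri<; tri≈; tri>)
open import Relation.Binary.PropositionalEquality
  using (_≡_; _≢_; refl; sym; trans; cong; cong₂; subst; subst₂; setoid; module ≡-Reasoning)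
import Relation.Binary.Reasoning.PartialOrder as PartialOrderReasoning
open import Relation.Binary.Structures using (IsTotalOrder)
open import Relation.Nullary using (¬_; yes; no; contradiction)

-- Sort v decreasingly and split the permutations of v into n blocks, the p-th block having the
-- maximum M in column p; deleting M turns a block into a set of permutations of the tail of v.
-- Pick nested sets S₀ ⊆ S₁ ⊆ … of such shorter permutations, one per block, each with weakly
-- increasing column sums.  The column sums of the union are again weakly increasing: for the
-- adjacent columns i, i+1, a block p ∉ {i, i+1} contributes in increasing order, and the blocks
-- i and i+1 together contribute the sum of M − (entry in column i) over Sᵢ₊₁ ∖ Sᵢ.  They are
-- strictly increasing if some S_t has strictly increasing column sums and |Sₜ₋₁| < |Sₜ| < |Sₜ₊₁|.
--
-- Put N = (n−1)! and k = q N + r with r < N.  If r > 0, take the sets ∅, …, ∅, X, full, …, full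
-- with |X| = r given by induction.  If r = 0, take ∅, …, ∅, B, A, full, …, full with |B| = 1,
-- |A| = N − 1 and B ⊆ A, which exist when n ≥ 4; the cases n = 3, k = 2 and k = 4 are explicit.

private
  variable
    a ℓ : Level
    A : Set a
    n : ℕ

-- Permutations, insertion of an index, pairs of adjacent columns.

Perms : ℕ → Set
Perms n = List (Permutation′ n)

insert-at : ∀ p q (π : Permutation′ n) → insert p q π ⟨$⟩ʳ p ≡ q
insert-at p q π with p Fin.≟ p
... | yes _   = refl
... | no  p≢p = contradiction refl p≢p

punchIn-inject₁ : (i : Fin n) → punchIn (inject₁ i) i ≡ suc i
punchIn-inject₁ zero    = refl
punchIn-inject₁ (suc i) = cong suc (punchIn-inject₁ i)

punchIn-suc : (i : Fin n) → punchIn (suc i) i ≡ inject₁ i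
punchIn-suc zero    = refl
punchIn-suc (suc i) = cong suc (punchIn-suc i)

-- The relation is a parameter because both the weak and the strict order on column sums are reduced
-- to adjacent columns this way.
adjacent⇒monotone : (_∼_ : Rel A ℓ) → Transitive _∼_ → (c : Vector A (suc n)) →
  (∀ i → c (inject₁ i) ∼ c (suc i)) → ∀ i j → i Fin.< j → c i ∼ c j
adjacent⇒monotone _∼_ tr c step zero (suc zero) _ = step zero
adjacent⇒monotone _∼_ tr c step zero (suc (suc j)) _ =
  tr (step zero) (adjacent⇒monotone _∼_ tr (c ∘ suc) (step ∘ suc) zero (suc j) z<s)
adjacent⇒monotone {n = suc n} _∼_ tr c step (suc i) (suc j) (s<s i<j) =
  adjacent⇒monotone _∼_ tr (c ∘ suc) (step ∘ suc) i j i<j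

-- The outer `punchIn` steps over `inject₁ i`; by `punchIn-inject₁` it carries the inner hole `i` to
-- `suc i`, so exactly these two adjacent positions are omitted.
skipPair : Fin (suc n) → Fin n → Fin (suc (suc n))
skipPair i q = punchIn (inject₁ i) (punchIn i q)

skipPair-≢-inject₁ : ∀ (i : Fin (suc n)) q → skipPair i q ≢ inject₁ i
skipPair-≢-inject₁ i q = Fin.punchInᵢ≢i (inject₁ i) (punchIn i q)

skipPair-≢-suc : ∀ (i : Fin (suc n)) q → skipPair i q ≢ suc i
skipPair-≢-suc i q eq = Fin.punchInᵢ≢i i q
  (Fin.punchIn-injective (inject₁ i) _ _ (trans eq (sym (punchIn-inject₁ i))))

skipPair-surjective : ∀ (i : Fin (suc n)) p → p ≢ inject₁ i → p ≢ suc i → ∃ λ q → skipPair i q ≡ p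
skipPair-surjective i p p≢i p≢i+1 =
  punchOut i≢p′ , trans (cong (punchIn (inject₁ i)) (Fin.punchIn-punchOut i≢p′)) (Fin.punchIn-punchOut i≢p)
  where
  i≢p : inject₁ i ≢ p
  i≢p = p≢i ∘ sym
  i≢p′ : i ≢ punchOut i≢p
  i≢p′ eq = p≢i+1 (trans (sym (Fin.punchIn-punchOut i≢p))
    (trans (cong (punchIn (inject₁ i)) (sym eq)) (punchIn-inject₁ i)))

-- Blocks of permutations and their sizes.

block : Fin (suc n) → Perms n → Perms (suc n)
block p = map (insert p zero)

blocks : Vector (Perms n) (suc n) → Perms (suc n)
blocks S = concat (tabulate (λ p → block p (S p)))

-- Sets of permutations are represented as sublists of this fixed enumeration, so an inclusion is
-- data to recurse on.
full : ∀ n → Perms n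
full zero    = Perm.id ∷ []
full (suc n) = blocks (const (full n))

blocks⁺ : {S T : Vector (Perms n) (suc n)} → (∀ p → S p ⊆ T p) → blocks S ⊆ blocks T
blocks⁺ S⊆T = SublistSetoid.concat⁺ (setoid _)
  (fromPointwise (Pointwise.tabulate⁺ (λ p → Sublist.map⁺ (insert p zero) (S⊆T p))))

lengths : Vector (List A) n → ℕ
lengths {n = zero}  S = 0
lengths {n = suc n} S = length (S zero) ℕ.+ lengths (S ∘ suc)

length-concat-tabulate : (S : Vector (List A) n) → length (concat (tabulate S)) ≡ lengths S
length-concat-tabulate {n = zero}  S = refl
length-concat-tabulate {n = suc n} S =
  trans (List.length-++ (S zero)) (cong (length (S zero) ℕ.+_) (length-concat-tabulate (S ∘ suc)))

lengths-cong : (S : Vector (List A) n) {B : Set} (T : Vector (List B) n) →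
  (∀ p → length (S p) ≡ length (T p)) → lengths S ≡ lengths T
lengths-cong {n = zero}  S T eq = refl
lengths-cong {n = suc n} S T eq = cong₂ ℕ._+_ (eq zero) (lengths-cong (S ∘ suc) (T ∘ suc) (eq ∘ suc))

lengths-const : ∀ n (xs : List A) → lengths {n = n} (const xs) ≡ n ℕ.* length xs
lengths-const zero    xs = refl
lengths-const (suc n) xs = cong (length xs ℕ.+_) (lengths-const n xs)

length-blocks : (S : Vector (Perms n) (suc n)) → length (blocks S) ≡ lengths S
length-blocks S = trans (length-concat-tabulate (λ p → block p (S p)))
  (lengths-cong (λ p → block p (S p)) S (λ p → List.length-map (insert p zero) (S p)))

length-full : ∀ n → length (full n) ≡ n !
length-full zero    = refl
length-full (suc n) = trans (length-blocks (const (full n)))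
  (trans (lengths-const (suc n) (full n)) (cong (suc n ℕ.*_) (length-full n)))

-- The enumeration has no repetitions.

Distinct : Rel (Permutation′ n) _
Distinct π ρ = ¬ (π Perm.≈ ρ)

insert-injective : ∀ p (π ρ : Permutation′ n) → insert p zero π Perm.≈ insert p zero ρ → π Perm.≈ ρ
insert-injective p π ρ eq i = Fin.suc-injective
  (trans (sym (insert-punchIn p zero π i)) (trans (eq (punchIn p i)) (insert-punchIn p zero ρ i)))

-- The permutation on the right sends both `p` and `q` to `zero`, and it is injective.
insert-determines-position : ∀ p q (π ρ : Permutation′ n) →
  insert p zero π Perm.≈ insert q zero ρ → p ≡ q
insert-determines-position p q π ρ eq = Injection.injective (↔⇒↣ (insert q zero ρ))
  (trans (sym (eq p)) (trans (insert-at p zero π) (sym (insert-at q zero ρ))))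

full-distinct : ∀ n → AllPairs Distinct (full n)
full-distinct zero    = [] ∷ []
full-distinct (suc n) = AllPairs.concat⁺
  (All.tabulate⁺ within)
  (AllPairs.tabulate⁺ {f = λ p → block p (full n)} λ {p} {q} → across p q)
  where
  within : ∀ p → AllPairs Distinct (block p (full n))
  within p = AllPairs.map⁺
    (AllPairs.map (λ {π} {ρ} π≉ρ → π≉ρ ∘ insert-injective p π ρ) (full-distinct n))

  across : ∀ p q → p ≢ q → All (λ π → All (Distinct π) (block q (full n))) (block p (full n))
  across p q p≢q = All.map⁺ (All.universal (λ π → All.map⁺
    (All.universal (λ ρ → p≢q ∘ insert-determines-position p q π ρ) (full n))) (full n))

AllPairs-resp-⊆ : {R : Rel A ℓ} {xs ys : List A} → xs ⊆ ys → AllPairs R ys → AllPairs R xs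
AllPairs-resp-⊆ []          []       = []
AllPairs-resp-⊆ (_ ∷ʳ τ)    (_ ∷ rs) = AllPairs-resp-⊆ τ rs
AllPairs-resp-⊆ (refl ∷ τ)  (r ∷ rs) = Sublist.All-resp-⊆ τ r ∷ AllPairs-resp-⊆ τ rs

AllPairs-lookup : {R : Rel A ℓ} {xs : List A} → AllPairs R xs →
  ∀ {i j} → i Fin.< j → R (lookup xs i) (lookup xs j)
AllPairs-lookup (r ∷ rs) {zero}  {suc j} _         = All.lookup r (∈-lookup j)
AllPairs-lookup (r ∷ rs) {suc i} {suc j} (s<s i<j) = AllPairs-lookup rs i<j

-- Nested families of sets.

-- ∅, …, ∅, X, Y, F, …, F with X at index t; when t is the last index, Y does not occur.
stack : Fin (suc n) → (X Y F : List A) → Vector (List A) (suc n)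
stack zero    X Y F zero          = X
stack zero    X Y F (suc zero)    = Y
stack zero    X Y F (suc (suc _)) = F
stack {n = suc n} (suc t) X Y F zero    = []
stack {n = suc n} (suc t) X Y F (suc p) = stack t X Y F p

module _ {X Y F : List A} where

  stack-at : (t : Fin (suc n)) → stack t X Y F t ≡ X
  stack-at zero = refl
  stack-at {n = suc n} (suc t) = stack-at t

  stack-all : (P : List A → Set ℓ) → P [] → P X → P Y → P F →
    (t p : Fin (suc n)) → P (stack t X Y F p)
  stack-all P p∅ pX pY pF zero zero          = pX
  stack-all P p∅ pX pY pF zero (suc zero)    = pY
  stack-all P p∅ pX pY pF zero (suc (suc _)) = pF
  stack-all {n = suc n} P p∅ pX pY pF (suc t) zero    = p∅
  stack-all {n = suc n} P p∅ pX pY pF (suc t) (suc p) = stack-all P p∅ pX pY pF t p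

  stack-nested : X ⊆ Y → Y ⊆ F → (t : Fin (suc n)) →
    ∀ i → stack t X Y F (inject₁ i) ⊆ stack t X Y F (suc i)
  stack-nested X⊆Y Y⊆F zero zero          = X⊆Y
  stack-nested X⊆Y Y⊆F zero (suc zero)    = Y⊆F
  stack-nested X⊆Y Y⊆F zero (suc (suc _)) = ⊆-refl
  stack-nested {n = suc n} X⊆Y Y⊆F (suc t) zero    = minimum _
  stack-nested {n = suc n} X⊆Y Y⊆F (suc t) (suc i) = stack-nested X⊆Y Y⊆F t i

  -- Only the adjacent pairs that contain `t` are concerned: the jump from `∅` to `X` just before
  -- `t`, and from `X` to `Y` just after it.
  stack-gap : 0 ℕ.< length X → length X ℕ.< length Y → (t : Fin (suc n)) →
    ∀ i → t ≡ inject₁ i ⊎ t ≡ suc i →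
    length (stack t X Y F (inject₁ i)) ℕ.< length (stack t X Y F (suc i))
  stack-gap 0<X X<Y zero zero _ = X<Y
  stack-gap 0<X X<Y zero (suc i) (inj₁ ())
  stack-gap 0<X X<Y zero (suc i) (inj₂ ())
  stack-gap {n = suc n} 0<X X<Y (suc zero) zero _ = 0<X
  stack-gap {n = suc n} 0<X X<Y (suc (suc t)) zero (inj₁ ())
  stack-gap {n = suc n} 0<X X<Y (suc (suc t)) zero (inj₂ ())
  stack-gap {n = suc n} 0<X X<Y (suc t) (suc i) (inj₁ eq) =
    stack-gap 0<X X<Y t i (inj₁ (Fin.suc-injective eq))
  stack-gap {n = suc n} 0<X X<Y (suc t) (suc i) (inj₂ eq) =
    stack-gap 0<X X<Y t i (inj₂ (Fin.suc-injective eq))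

lengths-stack-zero : (X Y F : List A) →
  lengths (stack {n = suc n} zero X Y F) ≡ length X ℕ.+ (length Y ℕ.+ n ℕ.* length F)
lengths-stack-zero {n = n} X Y F =
  cong (λ l → length X ℕ.+ (length Y ℕ.+ l)) (lengths-const n F)

lengths-stack-last : ∀ n (X Y F : List A) → lengths (stack (fromℕ n) X Y F) ≡ length X
lengths-stack-last zero    X Y F = ℕ.+-identityʳ (length X)
lengths-stack-last (suc n) X Y F = lengths-stack-last n X Y F

suc[n!∸1]≡n! : ∀ n → suc (n ! ∸ 1) ≡ n !
suc[n!∸1]≡n! n = ℕ.m+[n∸m]≡n (ℕ.1≤n! n)

n≤n! : ∀ n → n ≤ n !
n≤n! zero    = z≤n
n≤n! (suc n) = ℕ.m≤m*n (suc n) (n !) ⦃ ℕ.>-nonZero (ℕ.1≤n! n) ⦄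

module _ {c ℓ₁ ℓ₂} (G : OrderedAbelianGroup c ℓ₁ ℓ₂) where
  open OrderedAbelianGroup G using
    ( Carrier; _≈_; _≉_; _+_; 0#; -_; isTotalOrder; +-monoʳ-≤; abelianGroup; commutativeMonoid)
    renaming (_≤_ to _≼_)
  open AbelianGroup abelianGroup using (commutativeSemigroup)
    renaming (refl to ≈-refl; sym to ≈-sym; trans to ≈-trans;
      ∙-congˡ to +-congˡ; ∙-congʳ to +-congʳ; comm to +-comm; assoc to +-assoc;
      identityˡ to +-identityˡ; inverseˡ to -‿inverseˡ)
  open CommutativeSemigroupProperties commutativeSemigroup using (interchange; x∙yz≈y∙xz)
  open Sum commutativeMonoid using (sum; sum-remove)

  -- Inequalities in the ordered group.

  poset : Poset c ℓ₁ ℓ₂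
  poset = record { isPartialOrder = IsTotalOrder.isPartialOrder isTotalOrder }

  open Poset poset using (antisym; isPartialOrder)
    renaming (refl to ≼-refl; trans to ≼-trans; reflexive to ≼-reflexive)
  open ToStrict _≈_ _≼_ using (_<_; <⇒≤; <⇒≱; <-trans)
  module Reasoning = PartialOrderReasoning poset

  <-transitive : Transitive _<_
  <-transitive = <-trans isPartialOrder

  +-cancelˡ-≤ : ∀ x {y z} → x + y ≼ x + z → y ≼ z
  +-cancelˡ-≤ x {y} {z} x+y≼x+z = begin
    y              ≈⟨ cancel y ⟨
    - x + (x + y)  ≤⟨ +-monoʳ-≤ (- x) x+y≼x+z ⟩
    - x + (x + z)  ≈⟨ cancel z ⟩
    z              ∎
    where
    open Reasoning
    cancel : ∀ w → - x + (x + w) ≈ w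
    cancel w = ≈-trans (≈-sym (+-assoc _ _ _)) (≈-trans (+-congʳ (-‿inverseˡ x)) (+-identityˡ w))

  +-mono-≤ : ∀ {w x y z} → w ≼ x → y ≼ z → w + y ≼ x + z
  +-mono-≤ {w} {x} {y} {z} w≼x y≼z = begin
    w + y  ≤⟨ +-monoʳ-≤ w y≼z ⟩
    w + z  ≈⟨ +-comm w z ⟩
    z + w  ≤⟨ +-monoʳ-≤ z w≼x ⟩
    z + x  ≈⟨ +-comm z x ⟩
    x + z  ∎
    where open Reasoning

  +-monoʳ-< : ∀ x {y z} → y < z → x + y < x + z
  -- Equality of the two sums would cancel to `z ≼ y`, against `y < z`.
  +-monoʳ-< x y<z = +-monoʳ-≤ x (<⇒≤ y<z) ,
    λ eq → <⇒≱ antisym y<z (+-cancelˡ-≤ x (≼-reflexive (≈-sym eq)))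

  +-mono-≤-< : ∀ {w x y z} → w ≼ x → y < z → w + y < x + z
  +-mono-≤-< {w} {x} {y} {z} w≼x y<z = begin-strict
    w + y  <⟨ +-monoʳ-< w y<z ⟩
    w + z  ≤⟨ +-mono-≤ w≼x ≼-refl ⟩
    x + z  ∎
    where open Reasoning

  +-mono-<-≤ : ∀ {w x y z} → w < x → y ≼ z → w + y < x + z
  +-mono-<-≤ {w} {x} {y} {z} w<x y≼z = begin-strict
    w + y  ≈⟨ +-comm w y ⟩
    y + w  <⟨ +-mono-≤-< y≼z w<x ⟩
    z + x  ≈⟨ +-comm z x ⟩
    x + z  ∎
    where open Reasoning

  sum-mono-≤ : {f g : Vector Carrier n} → (∀ p → f p ≼ g p) → sum f ≼ sum g
  sum-mono-≤ {n = zero}  f≼g = ≼-refl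
  sum-mono-≤ {n = suc n} f≼g = +-mono-≤ (f≼g zero) (sum-mono-≤ (f≼g ∘ suc))

  sum-mono-< : {f g : Vector Carrier n} → (∀ p → f p ≼ g p) → ∀ p → f p < g p → sum f < sum g
  sum-mono-< f≼g zero    fp<gp = +-mono-<-≤ fp<gp (sum-mono-≤ (f≼g ∘ suc))
  sum-mono-< f≼g (suc p) fp<gp = +-mono-≤-< (f≼g zero) (sum-mono-< (f≼g ∘ suc) p fp<gp)

  sum-pair : ∀ i (f : Vector Carrier (suc (suc n))) →
    sum f ≈ (f (inject₁ i) + f (suc i)) + sum (f ∘ skipPair i)
  sum-pair i f = begin-equality
    sum f                                                           ≈⟨ sum-remove f ⟩
    f (inject₁ i) + sum f′                                          ≈⟨ +-congˡ (sum-remove f′) ⟩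
    f (inject₁ i) + (f (punchIn (inject₁ i) i) + sum (f ∘ skipPair i))
      ≡⟨ cong (λ p → f (inject₁ i) + (f p + sum (f ∘ skipPair i))) (punchIn-inject₁ i) ⟩
    f (inject₁ i) + (f (suc i) + sum (f ∘ skipPair i))              ≈⟨ +-assoc _ _ _ ⟨
    (f (inject₁ i) + f (suc i)) + sum (f ∘ skipPair i)              ∎
    where
    open Reasoning
    f′ : Vector Carrier _
    f′ = f ∘ punchIn (inject₁ i)

  -- Sums over lists and the deficit of a sublist.

  total : (A → Carrier) → List A → Carrier
  total f = foldr (λ x → f x +_) 0#

  total-++ : ∀ (f : A → Carrier) xs ys → total f (xs ++ ys) ≈ total f xs + total f ys
  total-++ f []       ys = ≈-sym (+-identityˡ _)
  total-++ f (x ∷ xs) ys = ≈-trans (+-congˡ (total-++ f xs ys)) (≈-sym (+-assoc _ _ _))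

  total-concat-tabulate : ∀ (f : A → Carrier) (S : Vector (List A) n) →
    total f (concat (tabulate S)) ≈ sum (total f ∘ S)
  total-concat-tabulate {n = zero}  f S = ≈-refl
  total-concat-tabulate {n = suc n} f S =
    ≈-trans (total-++ f (S zero) _) (+-congˡ (total-concat-tabulate f (S ∘ suc)))

  total-map : ∀ {B : Set} (f : B → Carrier) (h : A → B) (k : A → Carrier) →
    (∀ x → f (h x) ≡ k x) → ∀ xs → total f (map h xs) ≡ total k xs
  total-map f h k eq []       = refl
  total-map f h k eq (x ∷ xs) = cong₂ _+_ (eq x) (total-map f h k eq xs)

  -- For xs ⊆ ys the right side exceeds the left side by the sum of top − f x
  -- over the elements of ys missing from xs.
  module _ {f : A → Carrier} {top : Carrier} (f<top : ∀ x → f x < top) where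

    deficit-≤ : ∀ {xs ys} → xs ⊆ ys →
      total (const top) xs + total f ys ≼ total f xs + total (const top) ys
    deficit-< : ∀ {xs ys} → xs ⊆ ys → length xs ℕ.< length ys →
      total (const top) xs + total f ys < total f xs + total (const top) ys

    deficit-skip : ∀ {xs ys} → xs ⊆ ys → ∀ y →
      total (const top) xs + total f (y ∷ ys) < total f xs + total (const top) (y ∷ ys)
    deficit-skip {xs} {ys} τ y = begin-strict
      total (const top) xs + (f y + total f ys)  ≈⟨ x∙yz≈y∙xz _ _ _ ⟩
      f y + (total (const top) xs + total f ys)  <⟨ +-mono-<-≤ (f<top y) (deficit-≤ τ) ⟩
      top + (total f xs + total (const top) ys)  ≈⟨ x∙yz≈y∙xz _ _ _ ⟩
      total f xs + (top + total (const top) ys)  ∎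
      where open Reasoning

    deficit-≤ []                    = ≼-refl
    deficit-≤ (y ∷ʳ τ)              = <⇒≤ (deficit-skip τ y)
    deficit-≤ (_∷_ {x} {xs} {_} {ys} refl τ) = begin
      (top + total (const top) xs) + (f x + total f ys)  ≈⟨ interchange _ _ _ _ ⟩
      (top + f x) + (total (const top) xs + total f ys)  ≤⟨ +-mono-≤ (≼-reflexive (+-comm _ _)) (deficit-≤ τ) ⟩
      (f x + top) + (total f xs + total (const top) ys)  ≈⟨ interchange _ _ _ _ ⟩
      (f x + total f xs) + (top + total (const top) ys)  ∎
      where open Reasoning

    -- The length gap forces a skipped element somewhere; at the first one strictness is gained, and
    -- the weak bound suffices for the remainder.
    deficit-< (y ∷ʳ τ)  _                 = deficit-skip τ y
    deficit-< (_∷_ {x} {xs} {_} {ys} refl τ) (s<s xs<ys) = begin-strict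
      (top + total (const top) xs) + (f x + total f ys)  ≈⟨ interchange _ _ _ _ ⟩
      (top + f x) + (total (const top) xs + total f ys)
        <⟨ +-mono-≤-< (≼-reflexive (+-comm _ _)) (deficit-< τ xs<ys) ⟩
      (f x + top) + (total f xs + total (const top) ys)  ≈⟨ interchange _ _ _ _ ⟩
      (f x + total f xs) + (top + total (const top) ys)  ∎
      where open Reasoning

  -- Column sums of blocks and of their unions.

  Decreasing : Vector Carrier n → Set (ℓ₁ ⊔ ℓ₂)
  Decreasing u = ∀ i j → i Fin.< j → u j < u i

  colSum : Vector Carrier n → Perms n → Vector Carrier n
  colSum u L j = total (λ π → u (π ⟨$⟩ʳ j)) L

  -- Quantifying over every decreasing `u` lets the property of a shorter list be applied to
  -- `tail u`. As `u` decreases, index `zero`, which `insert p zero` puts in column `p`, holds the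
  -- maximum.
  Monotone : Rel Carrier ℓ → Perms n → Set (c ⊔ ℓ₁ ⊔ ℓ₂ ⊔ ℓ)
  Monotone _∼_ L = ∀ u → Decreasing u → ∀ i j → i Fin.< j → colSum u L i ∼ colSum u L j

  colSum-blocks : ∀ u (S : Vector (Perms n) (suc n)) j →
    colSum u (blocks S) j ≈ sum (λ p → colSum u (block p (S p)) j)
  colSum-blocks u S j = total-concat-tabulate (λ π → u (π ⟨$⟩ʳ j)) (λ p → block p (S p))

  colSum-block-at : ∀ (u : Vector Carrier (suc n)) p L →
    colSum u (block p L) p ≡ total (const (head u)) L
  colSum-block-at u p = total-map _ _ _ (λ π → cong u (insert-at p zero π))

  colSum-block-punchIn : ∀ (u : Vector Carrier (suc n)) p j L →
    colSum u (block p L) (punchIn p j) ≡ colSum (tail u) L j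
  colSum-block-punchIn u p j = total-map _ _ _ (λ π → cong u (insert-punchIn p zero π j))

  tail-decreasing : {u : Vector Carrier (suc n)} → Decreasing u → Decreasing (tail u)
  tail-decreasing u↓ i j i<j = u↓ (suc i) (suc j) (s<s i<j)

  -- Deleting column `p` preserves the order of the other columns, and what remains of the block is
  -- `L` acting on `tail u`.
  block-monotone : ∀ (_∼_ : Rel Carrier ℓ) (L : Perms n) → Monotone _∼_ L →
    ∀ {u} → Decreasing u → ∀ {p i j} → p ≢ i → p ≢ j → i Fin.< j →
    colSum u (block p L) i ∼ colSum u (block p L) j
  block-monotone _∼_ L mono {u} u↓ {p} {i} {j} p≢i p≢j i<j =
    subst₂ _∼_ (column p≢i) (column p≢j)
      (mono (tail u) (tail-decreasing u↓) _ _ (Fin.≤∧≢⇒<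
        (Fin.punchOut-mono-≤ p≢i p≢j (ℕ.<⇒≤ i<j))
        (Fin.<⇒≢ i<j ∘ Fin.punchOut-injective p≢i p≢j)))
    where
    column : ∀ {k} (p≢k : p ≢ k) → colSum (tail u) L (punchOut p≢k) ≡ colSum u (block p L) k
    column p≢k = trans (sym (colSum-block-punchIn u p (punchOut p≢k) L))
      (cong (colSum u (block p L)) (Fin.punchIn-punchOut p≢k))

  module _ (S : Vector (Perms (suc n)) (suc (suc n)))
    (nested : ∀ i → S (inject₁ i) ⊆ S (suc i)) {u : Vector Carrier (suc (suc n))} (u↓ : Decreasing u)
    where

    column : (j p : Fin (suc (suc n))) → Carrier
    column j p = colSum u (block p (S p)) j

    module _ (i : Fin (suc n)) where

      private
        left right : Fin (suc (suc n))
        left  = inject₁ i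
        right = suc i

        below-top : ∀ (π : Permutation′ (suc n)) → tail u (π ⟨$⟩ʳ i) < head u
        below-top π = u↓ zero (suc (π ⟨$⟩ʳ i)) z<s

        -- Once the maximum is deleted, column `left` of block `right` and column `right` of block
        -- `left` both become column `i`. Hence the two sides of the pair inequality involve one and
        -- the same function on `S left` and `S right`, as the deficit estimate requires.
        left-eq : column left left + column left right ≡
          total (const (head u)) (S left) + colSum (tail u) (S right) i
        left-eq = cong₂ _+_ (colSum-block-at u left (S left))
          (trans (cong (colSum u (block right (S right))) (sym (punchIn-suc i)))
            (colSum-block-punchIn u right i (S right)))

        right-eq : column right left + column right right ≡
          colSum (tail u) (S left) i + total (const (head u)) (S right)
        right-eq = cong₂ _+_
          (trans (cong (colSum u (block left (S left))) (sym (punchIn-inject₁ i)))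
            (colSum-block-punchIn u left i (S left)))
          (colSum-block-at u right (S right))

      pair-≤ : column left left + column left right ≼ column right left + column right right
      pair-≤ = subst₂ _≼_ (sym left-eq) (sym right-eq) (deficit-≤ below-top (nested i))

      pair-< : length (S left) ℕ.< length (S right) →
        column left left + column left right < column right left + column right right
      pair-< gap = subst₂ _<_ (sym left-eq) (sym right-eq) (deficit-< below-top (nested i) gap)

    colSum-blocks-pair : ∀ i j → colSum u (blocks S) j ≈
      (column j (inject₁ i) + column j (suc i)) + sum (column j ∘ skipPair i)
    colSum-blocks-pair i j = ≈-trans (colSum-blocks u S j) (sum-pair i (column j))

    module _ (nondescending : ∀ p → Monotone _≼_ (S p)) (i : Fin (suc n)) where

      private
        left right : Fin (suc (suc n))
        left  = inject₁ i
        right = suc i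

        left<right : left Fin.< right
        left<right = s≤s (ℕ.≤-reflexive (Fin.toℕ-inject₁ i))

        rest-≤ : ∀ q → column left (skipPair i q) ≼ column right (skipPair i q)
        rest-≤ q = block-monotone _≼_ (S (skipPair i q)) (nondescending (skipPair i q)) u↓
          (skipPair-≢-inject₁ i q) (skipPair-≢-suc i q) left<right

      blocks-adjacent-≤ : colSum u (blocks S) left ≼ colSum u (blocks S) right
      blocks-adjacent-≤ = begin
        colSum u (blocks S) left   ≈⟨ colSum-blocks-pair i left ⟩
        _                          ≤⟨ +-mono-≤ (pair-≤ i) (sum-mono-≤ rest-≤) ⟩
        _                          ≈⟨ colSum-blocks-pair i right ⟨
        colSum u (blocks S) right  ∎
        where open Reasoning

      blocks-adjacent-<-gap : length (S left) ℕ.< length (S right) →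
        colSum u (blocks S) left < colSum u (blocks S) right
      blocks-adjacent-<-gap gap = begin-strict
        colSum u (blocks S) left   ≈⟨ colSum-blocks-pair i left ⟩
        _                          <⟨ +-mono-<-≤ (pair-< i gap) (sum-mono-≤ rest-≤) ⟩
        _                          ≈⟨ colSum-blocks-pair i right ⟨
        colSum u (blocks S) right  ∎
        where open Reasoning

      -- Here the pair contributes only weakly; the strictness comes from block `t`, which is one of
      -- the remaining summands.
      blocks-adjacent-<-rest : ∀ t → Monotone _<_ (S t) → t ≢ left → t ≢ right →
        colSum u (blocks S) left < colSum u (blocks S) right
      blocks-adjacent-<-rest t ascending t≢left t≢right
        with skipPair-surjective i t t≢left t≢right
      ... | q , refl = begin-strict
        colSum u (blocks S) left   ≈⟨ colSum-blocks-pair i left ⟩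
        _                          <⟨ +-mono-≤-< (pair-≤ i) (sum-mono-< rest-≤ q
                                        (block-monotone _<_ (S t) ascending u↓ t≢left t≢right left<right)) ⟩
        _                          ≈⟨ colSum-blocks-pair i right ⟨
        colSum u (blocks S) right  ∎
        where open Reasoning

  NonDescending Ascending : Perms n → Set (c ⊔ ℓ₁ ⊔ ℓ₂)
  NonDescending L = Monotone _≼_ L
  Ascending     L = Monotone _<_ L

  ascending⇒nonDescending : (L : Perms n) → Ascending L → NonDescending L
  ascending⇒nonDescending L asc u u↓ i j i<j = <⇒≤ (asc u u↓ i j i<j)

  []-nonDescending : NonDescending {n} []
  []-nonDescending u u↓ i j i<j = ≼-refl

  blocks-nonDescending : (S : Vector (Perms n) (suc n)) → (∀ i → S (inject₁ i) ⊆ S (suc i)) →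
    (∀ p → NonDescending (S p)) → NonDescending (blocks S)
  blocks-nonDescending {n = zero}  S nested nd u u↓ zero zero ()
  blocks-nonDescending {n = suc n} S nested nd u u↓ =
    adjacent⇒monotone _≼_ ≼-trans (colSum u (blocks S)) (blocks-adjacent-≤ S nested u↓ nd)

  -- Each adjacent pair of columns either avoids `t`, and block `t` makes the step strict, or
  -- contains `t`, and the size gap does.
  blocks-ascending : (S : Vector (Perms n) (suc n)) → (∀ i → S (inject₁ i) ⊆ S (suc i)) →
    (∀ p → NonDescending (S p)) → ∀ t → Ascending (S t) →
    (∀ i → t ≡ inject₁ i ⊎ t ≡ suc i → length (S (inject₁ i)) ℕ.< length (S (suc i))) →
    Ascending (blocks S)
  blocks-ascending {n = zero}  S nested nd t asc gap u u↓ zero zero ()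
  blocks-ascending {n = suc n} S nested nd t asc gap u u↓ =
    adjacent⇒monotone _<_ <-transitive (colSum u (blocks S)) adjacent
    where
    adjacent : ∀ i → colSum u (blocks S) (inject₁ i) < colSum u (blocks S) (suc i)
    adjacent i with t Fin.≟ inject₁ i | t Fin.≟ suc i
    ... | yes t≡left | _           = blocks-adjacent-<-gap S nested u↓ nd i (gap i (inj₁ t≡left))
    ... | no _       | yes t≡right = blocks-adjacent-<-gap S nested u↓ nd i (gap i (inj₂ t≡right))
    ... | no t≢left  | no t≢right  = blocks-adjacent-<-rest S nested u↓ nd i t asc t≢left t≢right

  -- A constant family is nested, so the weak union lemma carries the property from `n` to `suc n`.
  full-nonDescending : ∀ n → NonDescending (full n)
  full-nonDescending zero    u u↓ ()
  full-nonDescending (suc n) =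
    blocks-nonDescending (const (full n)) (λ _ → ⊆-refl) (λ _ → full-nonDescending n)

  -- The inductive construction of selections.

  record Selection (n k : ℕ) : Set (c ⊔ ℓ₁ ⊔ ℓ₂) where
    field
      perms     : Perms n
      -- This serves twice: to nest the selection below full sets, and later to inherit distinctness
      -- of the rows.
      perms⊆    : perms ⊆ full n
      size      : length perms ≡ k
      ascending : Ascending perms
  open Selection

  -- The data for `X` and `Y` in a stack: `lower` is the strictly ascending member, and the two size
  -- inequalities are the gaps on either side of it.
  record Step (n : ℕ) : Set (c ⊔ ℓ₁ ⊔ ℓ₂) where
    field
      lower upper  : Perms n
      lower⊆upper  : lower ⊆ upper
      upper⊆       : upper ⊆ full n
      0<lower      : 0 ℕ.< length lower
      lower<upper  : length lower ℕ.< length upper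
      lower-asc    : Ascending lower
      upper-nd     : NonDescending upper
  open Step

  steps : Step n → Fin (suc n) → Vector (Perms n) (suc n)
  steps {n} s t = stack t (lower s) (upper s) (full n)

  stepSelection : ∀ (s : Step n) t → Selection (suc n) (lengths (steps s t))
  stepSelection {n} s t = record
    { perms     = blocks (steps s t)
    ; perms⊆    = blocks⁺ (stack-all (_⊆ full n) (minimum _)
                    (⊆-trans (lower⊆upper s) (upper⊆ s)) (upper⊆ s) ⊆-refl t)
    ; size      = length-blocks (steps s t)
    ; ascending = blocks-ascending (steps s t) (stack-nested (lower⊆upper s) (upper⊆ s) t)
        (stack-all NonDescending []-nonDescending (ascending⇒nonDescending (lower s) (lower-asc s))
          (upper-nd s) (full-nonDescending n) t)
        t (subst Ascending (sym (stack-at t)) (lower-asc s))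
        (stack-gap (0<lower s) (lower<upper s) t)
    }

  selectionStep : ∀ {k} → 0 ℕ.< k → k ℕ.< n ! → Selection n k → Step n
  selectionStep {n} 0<k k<n! s = record
    { lower = perms s ; upper = full n
    ; lower⊆upper = perms⊆ s ; upper⊆ = ⊆-refl
    ; 0<lower = subst (0 ℕ.<_) (sym (size s)) 0<k
    ; lower<upper = subst₂ ℕ._<_ (sym (size s)) (sym (length-full n)) k<n!
    ; lower-asc = ascending s ; upper-nd = full-nonDescending n
    }

  -- The two sets of `pair` have `n !` elements in total, so together they account for one full
  -- block when `n !` divides `k`.
  selectStep : ∀ {n} → (∀ k → 0 ℕ.< k → k ℕ.< n ! → Selection n k) →
    (s : Step n) → length (lower s) ≡ 1 → suc (length (upper s)) ≡ n ! →
    ∀ k → 0 ℕ.< k → k ℕ.< suc n ! → Selection (suc n) k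
  selectStep {n} select pair |lower|≡1 1+|upper|≡n! k 0<k k< =
    let s , t , eq = fill n k 0<k k< in subst (Selection (suc n)) eq (stepSelection s t)
    where
    F : Perms n
    F = full n

    -- Division by `n !` as a recursion on the number of blocks. While `k` is below the capacity of
    -- one block fewer, the first block stays empty; otherwise the stack starts here and the excess
    -- is the remainder.
    fill : ∀ m k → 0 ℕ.< k → k ℕ.< suc m ℕ.* n ! →
      Σ[ s ∈ Step n ] Σ[ t ∈ Fin (suc m) ] lengths (stack t (lower s) (upper s) F) ≡ k
    fill zero k 0<k k< = selectionStep 0<k k<n! (select k 0<k k<n!) , zero ,
      trans (ℕ.+-identityʳ _) (size (select k 0<k k<n!))
      where
      k<n! : k ℕ.< n !
      k<n! = subst (k ℕ.<_) (ℕ.*-identityˡ (n !)) k<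
    fill (suc m) k 0<k k< with k ℕ.<? suc m ℕ.* n !
    ... | yes k<′ = let s , t , eq = fill m k 0<k k<′ in s , suc t , eq
    ... | no  k≮  = remainder (k ∸ suc m ℕ.* n !) (ℕ.m+[n∸m]≡n (ℕ.≮⇒≥ k≮))
      where
      open ≡-Reasoning

      remainder : ∀ r → suc m ℕ.* n ! ℕ.+ r ≡ k →
        Σ[ s ∈ Step n ] Σ[ t ∈ Fin (suc (suc m)) ] lengths (stack t (lower s) (upper s) F) ≡ k
      -- Neither `∅` nor `full n` can play the role of `X`, so one `n !` is split as `1 + (n ! ∸ 1)`
      -- over the first two blocks, and `m` full blocks follow.
      remainder zero eq = pair , zero , (begin
        lengths (stack {n = suc m} zero (lower pair) (upper pair) F)
          ≡⟨ lengths-stack-zero {n = m} (lower pair) (upper pair) F ⟩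
        length (lower pair) ℕ.+ (length (upper pair) ℕ.+ m ℕ.* length F)
          ≡⟨ cong₂ (λ x y → x ℕ.+ (length (upper pair) ℕ.+ m ℕ.* y)) |lower|≡1 (length-full n) ⟩
        suc (length (upper pair)) ℕ.+ m ℕ.* n !
          ≡⟨ cong (ℕ._+ m ℕ.* n !) 1+|upper|≡n! ⟩
        suc m ℕ.* n !
          ≡⟨ ℕ.+-identityʳ _ ⟨
        suc m ℕ.* n ! ℕ.+ 0
          ≡⟨ eq ⟩
        k ∎)
      remainder (suc r) eq = selectionStep z<s r<n! X , zero , (begin
        lengths (stack {n = suc m} zero (perms X) F F)
          ≡⟨ lengths-stack-zero {n = m} (perms X) F F ⟩
        length (perms X) ℕ.+ suc m ℕ.* length F
          ≡⟨ cong₂ (λ x y → x ℕ.+ suc m ℕ.* y) (size X) (length-full n) ⟩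
        suc r ℕ.+ suc m ℕ.* n !
          ≡⟨ ℕ.+-comm (suc r) _ ⟩
        suc m ℕ.* n ! ℕ.+ suc r
          ≡⟨ eq ⟩
        k ∎)
        where
        r<n! : suc r ℕ.< n !
        r<n! = ℕ.+-cancelˡ-< (suc m ℕ.* n !) (suc r) (n !)
          (subst₂ ℕ._<_ (sym eq) (ℕ.+-comm (n !) (suc m ℕ.* n !)) k<)

        X : Selection n (suc r)
        X = select (suc r) z<s r<n!

  -- The upper set is (X, full, …, full) and the lower one (∅, …, ∅, Y), so they are nested
  -- whatever X and Y are.
  extremes : ∀ m → Selection (2 ℕ.+ m) 1 → Selection (2 ℕ.+ m) ((2 ℕ.+ m) ! ∸ 1) →
    Σ[ s ∈ Step (3 ℕ.+ m) ] (length (lower s) ≡ 1 × suc (length (upper s)) ≡ (3 ℕ.+ m) !)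
  extremes m one all-but-one = pair , |B|≡1 , 1+|A|≡
    where
    n₀ : ℕ
    n₀ = 2 ℕ.+ m

    1<n! : 1 ℕ.< n₀ !
    1<n! = ℕ.≤-trans (s≤s (s≤s z≤n)) (n≤n! n₀)

    low high : Step n₀
    low  = selectionStep z<s 1<n! one
    high = selectionStep (ℕ.m<n⇒0<n∸m 1<n!) (ℕ.≤-reflexive (suc[n!∸1]≡n! n₀)) all-but-one

    B : Selection (suc n₀) _
    B = stepSelection low (fromℕ n₀)

    A′ : Selection (suc n₀) _
    A′ = stepSelection high zero

    |B|≡1 : length (perms B) ≡ 1
    |B|≡1 = trans (size B) (trans (lengths-stack-last n₀ (lower low) _ _) (size one))

    1+|A|≡ : suc (length (perms A′)) ≡ suc n₀ !
    1+|A|≡ = begin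
      suc (length (perms A′))
        ≡⟨ cong suc (trans (size A′) (lengths-stack-zero {n = suc m} (perms all-but-one) (full n₀) (full n₀))) ⟩
      suc (length (perms all-but-one)) ℕ.+ n₀ ℕ.* length (full n₀)
        ≡⟨ cong₂ (λ x y → suc x ℕ.+ n₀ ℕ.* y) (size all-but-one) (length-full n₀) ⟩
      suc (n₀ ! ∸ 1) ℕ.+ n₀ ℕ.* n₀ !
        ≡⟨ cong (ℕ._+ n₀ ℕ.* n₀ !) (suc[n!∸1]≡n! n₀) ⟩
      suc n₀ ! ∎
      where open ≡-Reasoning

    low⊆full : ∀ p → steps low (fromℕ n₀) p ⊆ full n₀
    low⊆full = stack-all (_⊆ full n₀) (minimum _) (perms⊆ one) ⊆-refl ⊆-refl (fromℕ n₀)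

    low⊆high : ∀ p → steps low (fromℕ n₀) p ⊆ steps high zero p
    low⊆high zero          = minimum _
    low⊆high (suc zero)    = low⊆full (suc zero)
    low⊆high (suc (suc p)) = low⊆full (suc (suc p))

    pair : Step (suc n₀)
    pair = record
      { lower = perms B ; upper = perms A′
      ; lower⊆upper = blocks⁺ low⊆high ; upper⊆ = perms⊆ A′
      ; 0<lower = ℕ.≤-reflexive (sym |B|≡1)
      -- `A′` has at least two elements because `(3 + m) ! ≥ 3`. In dimension two both sets would
      -- have size one, whence the separate treatment of sizes 2 and 4 in dimension three.
      ; lower<upper = subst (ℕ._< length (perms A′)) (sym |B|≡1)
          (ℕ.≤-pred (subst (3 ≤_) (sym 1+|A|≡) (ℕ.≤-trans (s≤s (s≤s (s≤s z≤n))) (n≤n! (suc n₀)))))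
      ; lower-asc = ascending B
      ; upper-nd = ascending⇒nonDescending (perms A′) (ascending A′)
      }

  -- Dimensions two and three, and the full induction.

  adjacent⇒ascending : (L : Perms (suc n)) →
    (∀ u → Decreasing u → ∀ i → colSum u L (inject₁ i) < colSum u L (suc i)) → Ascending L
  adjacent⇒ascending L adjacent u u↓ =
    adjacent⇒monotone _<_ <-transitive (colSum u L) (adjacent u u↓)

  select-2-1 : Selection 2 1
  select-2-1 = record
    { perms     = L
    ; perms⊆    = _ ∷ʳ refl ∷ []
    ; size      = refl
    ; ascending = adjacent⇒ascending L λ { u u↓ zero → +-mono-<-≤ (u↓ zero (suc zero) z<s) ≼-refl }
    }
    where
    L : Perms 2
    L = insert (suc zero) zero (insert zero zero Perm.id) ∷ []

  -- p is the column of the largest entry, and q that of the second largest among the other two.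
  perm₃ : Fin 3 → Fin 2 → Permutation′ 3
  perm₃ p q = insert p zero (insert q zero (insert zero zero Perm.id))

  -- The rows are the two nontrivial cyclic shifts of `u`. With `u` itself they would form a Latin
  -- square, so column `j` sums to a constant minus `u j`, which increases with `j`.
  select-3-2 : Selection 3 2
  select-3-2 = record
    { perms     = L
    ; perms⊆    = _ ∷ʳ _ ∷ʳ _ ∷ʳ refl ∷ refl ∷ _ ∷ʳ []
    ; size      = refl
    ; ascending = adjacent⇒ascending L adjacent
    }
    where
    open Reasoning

    L : Perms 3
    L = perm₃ (suc zero) (suc zero) ∷ perm₃ (suc (suc zero)) zero ∷ []

    adjacent : ∀ u → Decreasing u → ∀ i → colSum u L (inject₁ i) < colSum u L (suc i)
    adjacent u u↓ zero = begin-strict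
      u (suc (suc zero)) + (u (suc zero) + 0#)  ≈⟨ x∙yz≈y∙xz _ _ _ ⟩
      u (suc zero) + (u (suc (suc zero)) + 0#)  <⟨ +-mono-<-≤ (u↓ zero (suc zero) z<s) ≼-refl ⟩
      u zero + (u (suc (suc zero)) + 0#)        ∎
    adjacent u u↓ (suc zero) = begin-strict
      u zero + (u (suc (suc zero)) + 0#)        ≈⟨ x∙yz≈y∙xz _ _ _ ⟩
      u (suc (suc zero)) + (u zero + 0#)        <⟨ +-mono-<-≤ (u↓ (suc zero) (suc (suc zero)) (s<s z<s)) ≼-refl ⟩
      u (suc zero) + (u zero + 0#)              ∎

  -- The first three rows are the cyclic shifts of `u` and contribute the same to each column; the
  -- fourth is the reversal of `u`, which is increasing.
  select-3-4 : Selection 3 4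
  select-3-4 = record
    { perms     = L
    ; perms⊆    = refl ∷ _ ∷ʳ _ ∷ʳ refl ∷ refl ∷ refl ∷ []
    ; size      = refl
    ; ascending = adjacent⇒ascending L adjacent
    }
    where
    open Reasoning

    L : Perms 3
    L = perm₃ zero zero ∷ perm₃ (suc zero) (suc zero) ∷
        perm₃ (suc (suc zero)) zero ∷ perm₃ (suc (suc zero)) (suc zero) ∷ []

    adjacent : ∀ u → Decreasing u → ∀ i → colSum u L (inject₁ i) < colSum u L (suc i)
    adjacent u u↓ zero = begin-strict
      x + (z + (y + (z + 0#)))  <⟨ +-monoʳ-< x (+-monoʳ-< z (+-monoʳ-< y (+-mono-<-≤ z<y ≼-refl))) ⟩
      x + (z + (y + (y + 0#)))  ≈⟨ +-congˡ (x∙yz≈y∙xz _ _ _) ⟩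
      x + (y + (z + (y + 0#)))  ≈⟨ x∙yz≈y∙xz _ _ _ ⟩
      y + (x + (z + (y + 0#)))  ∎
      where
      x y z : Carrier
      x = u zero
      y = u (suc zero)
      z = u (suc (suc zero))
      z<y : z < y
      z<y = u↓ (suc zero) (suc (suc zero)) (s<s z<s)
    adjacent u u↓ (suc zero) = begin-strict
      y + (x + (z + (y + 0#)))  <⟨ +-monoʳ-< y (+-monoʳ-< x (+-monoʳ-< z (+-mono-<-≤ y<x ≼-refl))) ⟩
      y + (x + (z + (x + 0#)))  ≈⟨ +-congˡ (x∙yz≈y∙xz _ _ _) ⟩
      y + (z + (x + (x + 0#)))  ≈⟨ x∙yz≈y∙xz _ _ _ ⟩
      z + (y + (x + (x + 0#)))  ∎
      where
      x y z : Carrier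
      x = u zero
      y = u (suc zero)
      z = u (suc (suc zero))
      y<x : y < x
      y<x = u↓ zero (suc zero) z<s

  -- Dimension `4 + m` takes its nonzero remainders from dimension `3 + m`, and the pair for
  -- remainder zero from the two extreme sizes in dimension `2 + m`.
  select : ∀ m k → 0 ℕ.< k → k ℕ.< (2 ℕ.+ m) ! → Selection (2 ℕ.+ m) k
  select 0 1 _ _ = select-2-1
  select 0 (suc (suc _)) _ (s≤s (s≤s ()))
  -- The odd sizes 1, 3, 5 come from the stacks `(∅, ∅, X)`, `(∅, X, F)` and `(X, F, F)` with `X` of
  -- size one and `F` of size two.
  select 1 1 _ _ = stepSelection (selectionStep z<s ℕ.≤-refl select-2-1) (suc (suc zero))
  select 1 2 _ _ = select-3-2
  select 1 3 _ _ = stepSelection (selectionStep z<s ℕ.≤-refl select-2-1) (suc zero)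
  select 1 4 _ _ = select-3-4
  select 1 5 _ _ = stepSelection (selectionStep z<s ℕ.≤-refl select-2-1) zero
  select 1 (suc (suc (suc (suc (suc (suc _)))))) _ (s≤s (s≤s (s≤s (s≤s (s≤s (s≤s ()))))))
  select (suc (suc m)) =
    let s , |lower|≡1 , 1+|upper|≡n! = extremes m (select m 1 z<s 1<n!)
          (select m (n₀ ! ∸ 1) (ℕ.m<n⇒0<n∸m 1<n!) (ℕ.≤-reflexive (suc[n!∸1]≡n! n₀)))
    in selectStep (select (suc m)) s |lower|≡1 1+|upper|≡n!
    where
    n₀ : ℕ
    n₀ = 2 ℕ.+ m

    1<n! : 1 ℕ.< n₀ !
    1<n! = ℕ.≤-trans (s≤s (s≤s z≤n)) (n≤n! n₀)

  -- Sorting the tuple and reading off the matrix.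

  argmax : (v : Vector Carrier (suc n)) → ∃ λ m → ∀ j → v j ≼ v m
  argmax {n = zero}  v = zero , λ { zero → ≼-refl }
  argmax {n = suc n} v with argmax (tail v)
  ... | m , v≼vm with IsTotalOrder.total isTotalOrder (head v) (v (suc m))
  ...   | inj₁ v0≼vm = suc m , λ { zero → v0≼vm ; (suc j) → v≼vm j }
  ...   | inj₂ vm≼v0 = zero  , λ { zero → ≼-refl ; (suc j) → ≼-trans (v≼vm j) vm≼v0 }

  -- Selection sort. Totality settles every comparison weakly and distinctness makes it strict, so
  -- `_≈_` is never decided.
  sort : (v : Vector Carrier n) → PairwiseDistinct G v →
    Σ[ ρ ∈ Permutation′ n ] Decreasing (λ j → v (ρ ⟨$⟩ʳ j))
  sort {n = zero}  v distinct = Perm.id , λ ()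
  sort {n = suc n} v distinct with argmax v
  ... | m , v≼vm with sort (v ∘ punchIn m)
          (λ i j i≢j → distinct _ _ (i≢j ∘ Fin.punchIn-injective m i j))
  ...   | ρ , ρ↓ = insert zero m ρ , λ
    { zero (suc j) _ → subst₂ _<_ (sym (later j)) refl
        (v≼vm _ , distinct _ _ (Fin.punchInᵢ≢i m _))
    ; (suc i) (suc j) (s<s i<j) → subst₂ _<_ (sym (later j)) (sym (later i)) (ρ↓ i j i<j)
    }
    where
    later : ∀ j → v (insert zero m ρ ⟨$⟩ʳ suc j) ≡ v (punchIn m (ρ ⟨$⟩ʳ j))
    later j = cong v (insert-punchIn zero m ρ j)

  sum-lookup : ∀ (f : A → Carrier) xs → sum (λ i → f (lookup xs i)) ≡ total f xs
  sum-lookup f []       = refl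
  sum-lookup f (x ∷ xs) = cong (f x +_) (sum-lookup f xs)

  selectionMatrix : (v : Vector Carrier n) → PairwiseDistinct G v → ∀ {k} → Selection n k →
    Σ[ A ∈ Matrix G k n ] (IsRowPermuted G v A × DCS G A)
  -- Matching `size` with `refl` turns `k` into `length L`, so the rows are indexed by positions in
  -- `L`.
  selectionMatrix {n = n} v distinct record { perms = L ; perms⊆ = L⊆ ; size = refl ; ascending = asc }
    with sort v distinct
  ... | ρ , ρ↓ = M , record
    { rows-permute  = λ i → (lookup L i ∘ₚ ρ) , λ _ → ≈-refl
    ; rows-distinct = rows-distinct
    } , λ i j i≢j eq → sums-distinct i j i≢j (subst₂ _≈_ (column-sum i) (column-sum j) eq)
    where
    u : Vector Carrier n
    u j = v (ρ ⟨$⟩ʳ j)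

    M : Matrix G (length L) n
    M i j = u (lookup L i ⟨$⟩ʳ j)

    equal-rows : ∀ (π π′ : Permutation′ n) → (∀ j → u (π ⟨$⟩ʳ j) ≈ u (π′ ⟨$⟩ʳ j)) → π Perm.≈ π′
    -- The case split is on indices in `Fin n`, where equality is decidable; different indices would
    -- give entries of `v` that are not equal.
    equal-rows π π′ eq j with (π ⟨$⟩ʳ j) Fin.≟ (π′ ⟨$⟩ʳ j)
    ... | yes same = same
    ... | no  diff = contradiction (eq j) (distinct _ _ (diff ∘ Injection.injective (↔⇒↣ ρ)))

    L-distinct : AllPairs Distinct L
    L-distinct = AllPairs-resp-⊆ L⊆ (full-distinct n)

    rows-distinct : ∀ i j → i ≢ j → ¬ (∀ l → M i l ≈ M j l)
    rows-distinct i j i≢j eq with Fin.<-cmp i j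
    ... | tri< i<j _ _ = AllPairs-lookup L-distinct i<j (equal-rows (lookup L i) (lookup L j) eq)
    ... | tri≈ _ i≡j _ = i≢j i≡j
    ... | tri> _ _ j<i = AllPairs-lookup L-distinct j<i (equal-rows (lookup L j) (lookup L i) (≈-sym ∘ eq))

    column-sum : ∀ j → columnSum G M j ≡ colSum u L j
    column-sum j = sum-lookup (λ π → u (π ⟨$⟩ʳ j)) L

    sums-distinct : ∀ i j → i ≢ j → colSum u L i ≉ colSum u L j
    sums-distinct i j i≢j eq with Fin.<-cmp i j
    ... | tri< i<j _ _ = proj₂ (asc u ρ↓ i j i<j) eq
    ... | tri≈ _ i≡j _ = i≢j i≡j
    ... | tri> _ _ j<i = proj₂ (asc u ρ↓ j i j<i) (≈-sym eq)

proposition2 : ∀ {c ℓ₁ ℓ₂} (G : OrderedAbelianGroup c ℓ₁ ℓ₂) (n : ℕ) → 2 ≤ n →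
    (v : Vector (OrderedAbelianGroup.Carrier G) n) → PairwiseDistinct G v →
    (k : ℕ) → 1 ≤ k → k ≤ n ! ∸ 1 →
    Σ[ A ∈ Matrix G k n ] (IsRowPermuted G v A × DCS G A)
proposition2 G (suc (suc m)) (s≤s (s≤s z≤n)) v distinct k 1≤k k≤n!∸1 =
  selectionMatrix G v distinct (select G m k 1≤k
    (ℕ.≤-trans (s≤s k≤n!∸1) (ℕ.≤-reflexive (suc[n!∸1]≡n! (suc (suc m))))))
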